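{- Let $r\ge 3$ and $n\ge 1$ be integers. Then $$ex_r^{\mathrm{lin}}(n,E_4^r)\le \frac{(2r-1)n}{r}.$$
   Context: All hypergraphs are finite. A hypergraph is $r$-uniform if each hyperedge has exactly $r$ vertices, and linear if any two distinct hyperedges intersect in at most one vertex. A hypergraph $H$ contains $F$ as a subhypergraph if there is an injective map $V(F)\to V(H)$ sending every hyperedge of $F$ to a hyperedge of $H$; otherwise $H$ is $F$-free. The linear Turán number $ex_r^{\mathrm{lin}}(n,F)$ is the maximum number of hyperedges in an $F$-free linear $r$-uniform hypergraph on $n$ vertices. The crown $E_4^r$ is the linear $r$-uniform hypergraph consisting of three pairwise disjoint hyperedges together with a fourth hyperedge (the base) that intersects each of the other three in exactly one vertex. -}

module Defs where

open import Data.Bool using (true; false; if_then_else_; _∧_; _∨_)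
open import Data.Bool.Properties using () renaming (_≟_ to _≟ᵇ_)
open import Data.Fin using (Fin; zero; suc; finToFun; funToFin)
import Data.Fin.Properties as Fin
open import Data.Fin.Subset using (Subset; _∈_; _∩_; _∪_; ∣_∣; ⁅_⁆; ⊤; ⊥)
open import Data.Fin.Subset.Properties
  using (_∈?_; anySubset?; ∣⊥∣≡0; ∣⊤∣≡n; ∣⁅x⁆∣≡1; ∩-identityˡ; ∩-identityʳ; ∩-zeroˡ; ∩-zeroʳ; ∩-comm;
         ∪-identityˡ; ∪-zeroˡ; ∪-zeroʳ)
open import Data.List as List using (List; []; _∷_; length)
import Data.List.Membership.DecPropositional as DecMembership
open import Data.List.Membership.Propositional using () renaming (_∈_ to _∈ˡ_)
open import Data.List.Membership.Propositional.Properties using (∈-lookup)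
open import Data.List.Relation.Unary.All as All using (All; []; _∷_)
open import Data.List.Relation.Unary.AllPairs using (AllPairs; []; _∷_)
open import Data.List.Relation.Unary.Any using (here; there)
import Data.List.Relation.Unary.Unique.DecPropositional as DecUnique
open import Data.List.Relation.Unary.Unique.Propositional using (Unique)
open import Data.Nat using (ℕ; zero; suc; _+_; _∸_; _^_; _≤_; z≤n; s≤s; _≤?_)
import Data.Nat.Properties as ℕ
open import Data.Product using (Σ-syntax; ∃-syntax; ∃; _×_; _,_; proj₁; proj₂)
open import Data.Sum using (inj₁; inj₂)
open import Data.Vec using (Vec; []; _∷_; _++_; tabulate; lookup; toList; fromList)
import Data.Vec.Properties as Vec
open import Function using (_∘_; Injective; mk⇔; Inverse)
open import Relation.Binary.PropositionalEquality
open import Relation.Nullary using (¬_; Dec; yes; no; does; contradiction)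
open import Relation.Nullary.Decidable using (map′; _×-dec_; _→-dec_; ¬?; does-⇔)
open import Relation.Unary using (Decidable)

private
  variable
    m n r : ℕ

-- A hypergraph on the vertex set Fin n.  The edges form a set of vertex sets,
-- so the list has no repetitions and its order carries no meaning.
record Hypergraph (n : ℕ) : Set where
  constructor hypergraph
  field
    edges  : List (Subset n)
    unique : Unique edges

open Hypergraph public

size : Hypergraph n → ℕ
size H = length (edges H)

Uniform : ℕ → Hypergraph n → Set
Uniform r H = ∀ e → e ∈ˡ edges H → ∣ e ∣ ≡ r

Linear : Hypergraph n → Set
Linear H = ∀ e e′ → e ∈ˡ edges H → e′ ∈ˡ edges H → e ≢ e′ → ∣ e ∩ e′ ∣ ≤ 1

hit? : (f : Fin m → Fin n) (e : Subset m) (v : Fin n) → Dec (∃[ u ] u ∈ e × f u ≡ v)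
hit? f e v = Fin.any? λ u → (u ∈? e) ×-dec (f u Fin.≟ v)

image : (Fin m → Fin n) → Subset m → Subset n
image f e = tabulate λ v → does (hit? f e v)

IsEmbedding : Hypergraph m → Hypergraph n → (Fin m → Fin n) → Set
IsEmbedding F H f = Injective _≡_ _≡_ f × (∀ e → e ∈ˡ edges F → image f e ∈ˡ edges H)

Contains : Hypergraph n → Hypergraph m → Set
Contains {n} {m} H F = ∃[ f ] IsEmbedding {m} {n} F H f

Free : Hypergraph m → Hypergraph n → Set
Free F H = ¬ Contains H F

record Admissible (r : ℕ) (F : Hypergraph m) (H : Hypergraph n) : Set where
  constructor admissible
  field
    uniform : Uniform r H
    linear  : Linear H
    free    : Free F H

Attains : (r n : ℕ) → Hypergraph m → ℕ → Set
Attains r n F s = Σ[ H ∈ Hypergraph n ] Admissible r F H × size H ≡ s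

_≟ˢ_ : (p q : Subset n) → Dec (p ≡ q)
_≟ˢ_ = Vec.≡-dec _≟ᵇ_

private
  _∈ˡ?_ : (e : Subset n) (es : List (Subset n)) → Dec (e ∈ˡ es)
  _∈ˡ?_ = DecMembership._∈?_ _≟ˢ_

  allEdges? : {P : Subset n → Set} → Decidable P → (es : List (Subset n)) →
              Dec (∀ e → e ∈ˡ es → P e)
  allEdges? P? es = map′ (λ ps e → All.lookup ps) (λ h → All.tabulate (h _)) (All.all? P? es)

uniform? : (r : ℕ) (H : Hypergraph n) → Dec (Uniform r H)
uniform? r H = allEdges? (λ e → ∣ e ∣ ℕ.≟ r) (edges H)

linear? : (H : Hypergraph n) → Dec (Linear H)
linear? H = map′ (λ h e e′ e∈ → h e e∈ e′) (λ h e e∈ e′ → h e e′ e∈)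
  (allEdges? (λ e → allEdges? (λ e′ → ¬? (e ≟ˢ e′) →-dec (∣ e ∩ e′ ∣ ≤? 1)) (edges H)) (edges H))

image-cong : {f g : Fin m → Fin n} → f ≗ g → (e : Subset m) → image f e ≡ image g e
image-cong {f = f} {g} f≗g e = Vec.tabulate-cong λ v → does-⇔
  (mk⇔ (λ (u , u∈e , fu≡v) → u , u∈e , trans (sym (f≗g u)) fu≡v)
       (λ (u , u∈e , gu≡v) → u , u∈e , trans (f≗g u) gu≡v))
  (hit? f e v) (hit? g e v)

isEmbedding-cong : (F : Hypergraph m) (H : Hypergraph n) {f g : Fin m → Fin n} → f ≗ g →
                   IsEmbedding F H f → IsEmbedding F H g
isEmbedding-cong F H f≗g (inj , pres) =
  (λ {x} {y} gx≡gy → inj (trans (f≗g x) (trans gx≡gy (sym (f≗g y))))) ,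
  (λ e e∈F → subst (_∈ˡ edges H) (image-cong f≗g e) (pres e e∈F))

isEmbedding? : (F : Hypergraph m) (H : Hypergraph n) → Decidable (IsEmbedding F H)
isEmbedding? F H f =
  map′ (λ h {x} {y} → h x y) (λ h x y → h {x} {y})
    (Fin.all? λ x → Fin.all? λ y → (f x Fin.≟ f y) →-dec (x Fin.≟ y))
  ×-dec allEdges? (λ e → image f e ∈ˡ? edges H) (edges F)

contains? : (H : Hypergraph n) (F : Hypergraph m) → Dec (Contains H F)
contains? H F = map′
  (λ (i , emb) → finToFun i , emb)
  (λ (f , emb) → funToFin f ,
    isEmbedding-cong F H (λ x → sym (Fin.finToFun-funToFin f x)) emb)
  (Fin.any? λ i → isEmbedding? F H (finToFun i))

admissible? : (r : ℕ) (F : Hypergraph m) (H : Hypergraph n) → Dec (Admissible r F H)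
admissible? r F H = map′ (λ (u , l , f) → admissible u l f)
  (λ (admissible u l f) → u , l , f)
  (uniform? r H ×-dec linear? H ×-dec ¬? (contains? H F))

private
  anyVec? : ∀ s {P : Vec (Subset n) s → Set} → Decidable P → Dec (∃ P)
  anyVec? zero    P? = map′ (λ p → [] , p) (λ where ([] , p) → p) (P? [])
  anyVec? (suc s) P? = map′ (λ (e , es , p) → (e ∷ es) , p)
    (λ where (e ∷ es , p) → e , es , p)
    (anySubset? λ e → anyVec? s λ es → P? (e ∷ es))

  admissibleList? : (r : ℕ) (F : Hypergraph m) (es : List (Subset n)) →
                    Dec (Σ[ u ∈ Unique es ] Admissible r F (hypergraph es u))
  admissibleList? r F es with DecUnique.unique? _≟ˢ_ es
  ... | no ¬u = no (¬u ∘ proj₁)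
  ... | yes u = map′ (u ,_) (λ (_ , admissible a b c) → admissible a b c)
                     (admissible? r F (hypergraph es u))

  Bundled : (r : ℕ) → Hypergraph m → List (Subset n) → Set
  Bundled r F es = Σ[ u ∈ Unique es ] Admissible r F (hypergraph es u)

  length-toList : ∀ {s} (es : Vec (Subset n) s) → length (toList es) ≡ s
  length-toList []       = refl
  length-toList (_ ∷ es) = cong suc (length-toList es)

attains? : (r n : ℕ) (F : Hypergraph m) → Decidable (Attains r n F)
attains? r n F s = map′
  (λ (es , u , a) → hypergraph (toList es) u , a , length-toList es)
  (λ where (hypergraph es u , a , refl) →
             fromList es , subst (Bundled r F) (sym (Vec.toList∘fromList es)) (u , a))
  (anyVec? s λ es → admissibleList? r F (toList es))

-- The greatest s ≤ b satisfying P, or 0 if there is none.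
greatest : {P : ℕ → Set} → Decidable P → ℕ → ℕ
greatest P? zero    = zero
greatest P? (suc b) = if does (P? (suc b)) then suc b else greatest P? b

-- The maximum of size H over the admissible H on n vertices: the bound 2 ^ n loses
-- nothing (size≤2^n), and exLin-upper and exLin-attained show it is that maximum.
exLin : (r n : ℕ) → Hypergraph m → ℕ
exLin r n F = greatest (attains? r n F) (2 ^ n)

private
  greatest-upper : {P : ℕ → Set} (P? : Decidable P) (b : ℕ) {s : ℕ} →
                   P s → s ≤ b → s ≤ greatest P? b
  greatest-upper P? zero    p s≤b = s≤b
  greatest-upper P? (suc b) p s≤b with P? (suc b)
  ... | yes _ = s≤b
  ... | no ¬p with ℕ.m≤n⇒m<n∨m≡n s≤b
  ...   | inj₁ (s≤s s≤b′) = greatest-upper P? b p s≤b′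
  ...   | inj₂ refl       = contradiction p ¬p

  greatest-attained : {P : ℕ → Set} (P? : Decidable P) (b : ℕ) {s : ℕ} →
                      P s → s ≤ b → P (greatest P? b)
  greatest-attained P? zero    p z≤n = p
  greatest-attained P? (suc b) p s≤b with P? (suc b)
  ... | yes q = q
  ... | no ¬p with ℕ.m≤n⇒m<n∨m≡n s≤b
  ...   | inj₁ (s≤s s≤b′) = greatest-attained P? b p s≤b′
  ...   | inj₂ refl       = contradiction p ¬p

  code : Subset n → Fin (2 ^ n)
  code p = funToFin (Inverse.from Fin.2↔Bool ∘ lookup p)

  code-injective : {p q : Subset n} → code p ≡ code q → p ≡ q
  code-injective {p = p} {q} eq = begin
    p                    ≡⟨ Vec.tabulate∘lookup p ⟨
    tabulate (lookup p)  ≡⟨ Vec.tabulate-cong same ⟩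
    tabulate (lookup q)  ≡⟨ Vec.tabulate∘lookup q ⟩
    q                    ∎
    where
    open ≡-Reasoning
    from = Inverse.from Fin.2↔Bool
    to   = Inverse.to Fin.2↔Bool
    same : lookup p ≗ lookup q
    same i = begin
      lookup p i              ≡⟨ Inverse.strictlyInverseˡ Fin.2↔Bool (lookup p i) ⟨
      to (from (lookup p i))  ≡⟨ cong to (Fin.finToFun-funToFin (from ∘ lookup p) i) ⟨
      to (finToFun (code p) i) ≡⟨ cong (λ c → to (finToFun c i)) eq ⟩
      to (finToFun (code q) i) ≡⟨ cong to (Fin.finToFun-funToFin (from ∘ lookup q) i) ⟩
      to (from (lookup q i))  ≡⟨ Inverse.strictlyInverseˡ Fin.2↔Bool (lookup q i) ⟩
      lookup q i              ∎

  index : {A : Set} (xs : List A) → Fin (length xs) → A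
  index = List.lookup

  index-injective : {A : Set} {xs : List A} → Unique xs → Injective _≡_ _≡_ (index xs)
  index-injective (_ ∷ _)    {zero}  {zero}  _  = refl
  index-injective (x∉ ∷ _)   {zero}  {suc j} eq = contradiction eq (All.lookup x∉ (∈-lookup j))
  index-injective (x∉ ∷ _)   {suc i} {zero}  eq = contradiction (sym eq) (All.lookup x∉ (∈-lookup i))
  index-injective (_ ∷ uniq) {suc i} {suc j} eq = cong suc (index-injective uniq eq)

size≤2^n : (H : Hypergraph n) → size H ≤ 2 ^ n
size≤2^n H = Fin.injective⇒≤ {f = code ∘ index (edges H)}
  (index-injective (unique H) ∘ code-injective)

exLin-upper : (F : Hypergraph m) (H : Hypergraph n) → Admissible r F H → size H ≤ exLin r n F
exLin-upper {n = n} {r = r} F H a =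
  greatest-upper (attains? r n F) (2 ^ n) (H , a , refl) (size≤2^n H)

exLin-attained : (F : Hypergraph m) (H : Hypergraph n) → Admissible r F H →
                 Attains r n F (exLin r n F)
exLin-attained {n = n} {r = r} F H a =
  greatest-attained (attains? r n F) (2 ^ n) (H , a , refl) (size≤2^n H)

-- If F has an edge, the edgeless hypergraph is admissible, so the maximum exists.
edgeless-admissible : (F : Hypergraph m) {e : Subset m} → e ∈ˡ edges F →
                      Admissible r F (hypergraph {n} [] [])
edgeless-admissible F e∈F = admissible (λ _ ()) (λ _ _ ()) (λ (_ , _ , pres) → case[] (pres _ e∈F))
  where
  case[] : {A : Set} {x : Subset n} → x ∈ˡ [] → A
  case[] ()

module Crown (k : ℕ) where

  private
    r′ : ℕ
    r′ = 3 + k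

  Vertices : ℕ
  Vertices = r′ + (r′ + (r′ + k))

  blocks : Subset r′ → Subset r′ → Subset r′ → Subset k → Subset Vertices
  blocks a b c d = a ++ (b ++ (c ++ d))

  leg₁ leg₂ leg₃ base : Subset Vertices
  leg₁ = blocks ⊤ ⊥ ⊥ ⊥
  leg₂ = blocks ⊥ ⊤ ⊥ ⊥
  leg₃ = blocks ⊥ ⊥ ⊤ ⊥
  base = blocks ⁅ zero ⁆ ⁅ zero ⁆ ⁅ zero ⁆ ⊤

  distinct : Unique (base ∷ leg₁ ∷ leg₂ ∷ leg₃ ∷ [])
  distinct = ((λ ()) ∷ (λ ()) ∷ (λ ()) ∷ []) ∷ ((λ ()) ∷ (λ ()) ∷ [])
           ∷ (leg₂≢leg₃ ∷ []) ∷ [] ∷ []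
    where
    leg₂≢leg₃ : leg₂ ≢ leg₃
    leg₂≢leg₃ eq with () ← Vec.++-injectiveʳ (⊥ {r′}) ⊥ eq

crownOrder : (r : ℕ) → ℕ
crownOrder r = r + (r + (r + (r ∸ 3)))

-- The base takes the first vertex of each of the three legs, and r ∸ 3 further
-- vertices of its own.
crown : (r : ℕ) → 3 ≤ r → Hypergraph (crownOrder r)
crown (suc (suc (suc k))) _ = hypergraph (base ∷ leg₁ ∷ leg₂ ∷ leg₃ ∷ []) distinct
  where open Crown k
crown 1 (s≤s ())
crown 2 (s≤s (s≤s ()))

-- The properties that define the crown up to isomorphism: there are no edges
-- other than the base and the legs, and no isolated vertices.
record IsCrown (r : ℕ) (F : Hypergraph n) : Set where
  field
    base leg₁ leg₂ leg₃ : Subset n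
    edges≡   : edges F ≡ base ∷ leg₁ ∷ leg₂ ∷ leg₃ ∷ []
    uniform  : Uniform r F
    linear   : Linear F
    disj₁₂   : ∣ leg₁ ∩ leg₂ ∣ ≡ 0
    disj₁₃   : ∣ leg₁ ∩ leg₃ ∣ ≡ 0
    disj₂₃   : ∣ leg₂ ∩ leg₃ ∣ ≡ 0
    meets₁   : ∣ base ∩ leg₁ ∣ ≡ 1
    meets₂   : ∣ base ∩ leg₂ ∣ ≡ 1
    meets₃   : ∣ base ∩ leg₃ ∣ ≡ 1
    covers   : base ∪ (leg₁ ∪ (leg₂ ∪ leg₃)) ≡ ⊤

private
  ∣++∣ : (p : Subset m) (q : Subset n) → ∣ p ++ q ∣ ≡ ∣ p ∣ + ∣ q ∣
  ∣++∣ []          q = refl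
  ∣++∣ (true ∷ p)  q = cong suc (∣++∣ p q)
  ∣++∣ (false ∷ p) q = ∣++∣ p q

  ⊤++⊤ : ∀ m → ⊤ {m} ++ ⊤ {n} ≡ ⊤ {m + n}
  ⊤++⊤ zero    = refl
  ⊤++⊤ (suc m) = cong (true ∷_) (⊤++⊤ m)

  linearFromPairs : (H : Hypergraph n) → AllPairs (λ e e′ → ∣ e ∩ e′ ∣ ≤ 1) (edges H) → Linear H
  linearFromPairs H pss e e′ = go pss
    where
    go : ∀ {es} → AllPairs (λ e e′ → ∣ e ∩ e′ ∣ ≤ 1) es →
         ∀ {e e′} → e ∈ˡ es → e′ ∈ˡ es → e ≢ e′ → ∣ e ∩ e′ ∣ ≤ 1
    go (ps ∷ _)  (here refl) (here refl) e≢e = contradiction refl e≢e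
    go (ps ∷ _)  (here refl) (there y)   _   = All.lookup ps y
    go (ps ∷ _) {e} {e′} (there x) (here refl) _ =
      subst (λ z → ∣ z ∣ ≤ 1) (∩-comm e′ e) (All.lookup ps x)
    go (_ ∷ pss) (there x)   (there y)   ne  = go pss x y ne

module _ (k : ℕ) where
  open Crown k

  private
    s₁ : Subset (3 + k)
    s₁ = ⁅ zero ⁆

    ∣s₁∣ : ∣ s₁ ∣ ≡ 1
    ∣s₁∣ = ∣⁅x⁆∣≡1 {3 + k} zero

    ∣blocks∣ : ∀ a b c d {w x y z} → ∣ a ∣ ≡ w → ∣ b ∣ ≡ x → ∣ c ∣ ≡ y → ∣ d ∣ ≡ z →
               ∣ blocks a b c d ∣ ≡ w + (x + (y + z))
    ∣blocks∣ a b c d refl refl refl refl =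
      trans (∣++∣ a _) (cong (∣ a ∣ +_) (trans (∣++∣ b _) (cong (∣ b ∣ +_) (∣++∣ c d))))

    blocks-∩ : ∀ a b c d a′ b′ c′ d′ → blocks a b c d ∩ blocks a′ b′ c′ d′
               ≡ blocks (a ∩ a′) (b ∩ b′) (c ∩ c′) (d ∩ d′)
    blocks-∩ a b c d a′ b′ c′ d′ =
      trans (Vec.zipWith-++ _∧_ a (b ++ (c ++ d)) a′ (b′ ++ (c′ ++ d′))) (cong ((a ∩ a′) ++_)
        (trans (Vec.zipWith-++ _∧_ b (c ++ d) b′ (c′ ++ d′)) (cong ((b ∩ b′) ++_)
          (Vec.zipWith-++ _∧_ c d c′ d′))))

    blocks-∪ : ∀ a b c d a′ b′ c′ d′ → blocks a b c d ∪ blocks a′ b′ c′ d′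
               ≡ blocks (a ∪ a′) (b ∪ b′) (c ∪ c′) (d ∪ d′)
    blocks-∪ a b c d a′ b′ c′ d′ =
      trans (Vec.zipWith-++ _∨_ a (b ++ (c ++ d)) a′ (b′ ++ (c′ ++ d′))) (cong ((a ∪ a′) ++_)
        (trans (Vec.zipWith-++ _∨_ b (c ++ d) b′ (c′ ++ d′)) (cong ((b ∪ b′) ++_)
          (Vec.zipWith-++ _∨_ c d c′ d′))))

    ∣_∩⊥∣ : (p : Subset n) → ∣ p ∩ ⊥ ∣ ≡ 0
    ∣_∩⊥∣ {n} p = trans (cong ∣_∣ (∩-zeroʳ p)) (∣⊥∣≡0 n)

    ∣⊥∩_∣ : (p : Subset n) → ∣ ⊥ ∩ p ∣ ≡ 0
    ∣⊥∩_∣ {n} p = trans (cong ∣_∣ (∩-zeroˡ p)) (∣⊥∣≡0 n)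

    ∣s₁∩⊤∣ : ∣ s₁ ∩ ⊤ ∣ ≡ 1
    ∣s₁∩⊤∣ = trans (cong ∣_∣ (∩-identityʳ s₁)) ∣s₁∣

    ∣leg₁∣ : ∣ leg₁ ∣ ≡ 3 + k
    ∣leg₁∣ = trans (∣blocks∣ ⊤ ⊥ ⊥ ⊥ (∣⊤∣≡n (3 + k)) (∣⊥∣≡0 (3 + k)) (∣⊥∣≡0 (3 + k)) (∣⊥∣≡0 k))
                   (ℕ.+-identityʳ (3 + k))

    ∣leg₂∣ : ∣ leg₂ ∣ ≡ 3 + k
    ∣leg₂∣ = trans (∣blocks∣ ⊥ ⊤ ⊥ ⊥ (∣⊥∣≡0 (3 + k)) (∣⊤∣≡n (3 + k)) (∣⊥∣≡0 (3 + k)) (∣⊥∣≡0 k))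
                   (ℕ.+-identityʳ (3 + k))

    ∣leg₃∣ : ∣ leg₃ ∣ ≡ 3 + k
    ∣leg₃∣ = trans (∣blocks∣ ⊥ ⊥ ⊤ ⊥ (∣⊥∣≡0 (3 + k)) (∣⊥∣≡0 (3 + k)) (∣⊤∣≡n (3 + k)) (∣⊥∣≡0 k))
                   (ℕ.+-identityʳ (3 + k))

    ∣base∣ : ∣ base ∣ ≡ 3 + k
    ∣base∣ = ∣blocks∣ s₁ s₁ s₁ ⊤ ∣s₁∣ ∣s₁∣ ∣s₁∣ (∣⊤∣≡n k)

    ∣∩∣ : ∀ a b c d a′ b′ c′ d′ {w x y z} →
          ∣ a ∩ a′ ∣ ≡ w → ∣ b ∩ b′ ∣ ≡ x → ∣ c ∩ c′ ∣ ≡ y → ∣ d ∩ d′ ∣ ≡ z →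
          ∣ blocks a b c d ∩ blocks a′ b′ c′ d′ ∣ ≡ w + (x + (y + z))
    ∣∩∣ a b c d a′ b′ c′ d′ p q u v =
      trans (cong ∣_∣ (blocks-∩ a b c d a′ b′ c′ d′))
            (∣blocks∣ (a ∩ a′) (b ∩ b′) (c ∩ c′) (d ∩ d′) p q u v)

    ⊥̂ ⊤̂ : Subset (3 + k)
    ⊥̂ = ⊥
    ⊤̂ = ⊤

    d₁₂ : ∣ leg₁ ∩ leg₂ ∣ ≡ 0
    d₁₂ = ∣∩∣ ⊤̂ ⊥̂ ⊥̂ ⊥ ⊥̂ ⊤̂ ⊥̂ ⊥ ∣ ⊤̂ ∩⊥∣ ∣⊥∩ ⊤̂ ∣ ∣⊥∩ ⊥̂ ∣ (∣⊥∩_∣ {k} ⊥)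

    d₁₃ : ∣ leg₁ ∩ leg₃ ∣ ≡ 0
    d₁₃ = ∣∩∣ ⊤̂ ⊥̂ ⊥̂ ⊥ ⊥̂ ⊥̂ ⊤̂ ⊥ ∣ ⊤̂ ∩⊥∣ ∣⊥∩ ⊥̂ ∣ ∣⊥∩ ⊤̂ ∣ (∣⊥∩_∣ {k} ⊥)

    d₂₃ : ∣ leg₂ ∩ leg₃ ∣ ≡ 0
    d₂₃ = ∣∩∣ ⊥̂ ⊤̂ ⊥̂ ⊥ ⊥̂ ⊥̂ ⊤̂ ⊥ ∣⊥∩ ⊥̂ ∣ ∣ ⊤̂ ∩⊥∣ ∣⊥∩ ⊤̂ ∣ (∣⊥∩_∣ {k} ⊥)

    m₁ : ∣ base ∩ leg₁ ∣ ≡ 1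
    m₁ = ∣∩∣ s₁ s₁ s₁ ⊤ ⊤̂ ⊥̂ ⊥̂ ⊥ ∣s₁∩⊤∣ ∣ s₁ ∩⊥∣ ∣ s₁ ∩⊥∣ (∣_∩⊥∣ {k} ⊤)

    m₂ : ∣ base ∩ leg₂ ∣ ≡ 1
    m₂ = ∣∩∣ s₁ s₁ s₁ ⊤ ⊥̂ ⊤̂ ⊥̂ ⊥ ∣ s₁ ∩⊥∣ ∣s₁∩⊤∣ ∣ s₁ ∩⊥∣ (∣_∩⊥∣ {k} ⊤)

    m₃ : ∣ base ∩ leg₃ ∣ ≡ 1
    m₃ = ∣∩∣ s₁ s₁ s₁ ⊤ ⊥̂ ⊥̂ ⊤̂ ⊥ ∣ s₁ ∩⊥∣ ∣ s₁ ∩⊥∣ ∣s₁∩⊤∣ (∣_∩⊥∣ {k} ⊤)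

    ≤1 : ∀ {a} → a ≡ 0 → a ≤ 1
    ≤1 refl = z≤n

    covered : base ∪ (leg₁ ∪ (leg₂ ∪ leg₃)) ≡ ⊤
    covered = begin
      base ∪ (leg₁ ∪ (leg₂ ∪ leg₃))
        ≡⟨ cong (λ p → base ∪ (leg₁ ∪ p)) (blocks-∪ ⊥̂ ⊤̂ ⊥̂ ⊥ ⊥̂ ⊥̂ ⊤̂ ⊥) ⟩
      base ∪ (leg₁ ∪ blocks (⊥̂ ∪ ⊥̂) (⊤̂ ∪ ⊥̂) (⊥̂ ∪ ⊤̂) (⊥ ∪ ⊥))
        ≡⟨ cong (base ∪_) (blocks-∪ ⊤̂ ⊥̂ ⊥̂ ⊥ (⊥̂ ∪ ⊥̂) (⊤̂ ∪ ⊥̂) (⊥̂ ∪ ⊤̂) (⊥ ∪ ⊥)) ⟩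
      base ∪ blocks (⊤̂ ∪ (⊥̂ ∪ ⊥̂)) (⊥̂ ∪ (⊤̂ ∪ ⊥̂)) (⊥̂ ∪ (⊥̂ ∪ ⊤̂)) (⊥ ∪ (⊥ ∪ ⊥))
        ≡⟨ blocks-∪ s₁ s₁ s₁ ⊤ (⊤̂ ∪ (⊥̂ ∪ ⊥̂)) (⊥̂ ∪ (⊤̂ ∪ ⊥̂)) (⊥̂ ∪ (⊥̂ ∪ ⊤̂)) (⊥ ∪ (⊥ ∪ ⊥)) ⟩
      blocks (s₁ ∪ (⊤̂ ∪ (⊥̂ ∪ ⊥̂))) (s₁ ∪ (⊥̂ ∪ (⊤̂ ∪ ⊥̂))) (s₁ ∪ (⊥̂ ∪ (⊥̂ ∪ ⊤̂))) (⊤ ∪ (⊥ ∪ (⊥ ∪ ⊥)))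
        ≡⟨ blocks-cong (full (∪-zeroˡ (⊥̂ ∪ ⊥̂)))
                       (full (trans (∪-identityˡ (⊤̂ ∪ ⊥̂)) (∪-zeroˡ ⊥̂)))
                       (full (trans (∪-identityˡ (⊥̂ ∪ ⊤̂)) (∪-identityˡ ⊤̂)))
                       (∪-zeroˡ (⊥ ∪ (⊥ ∪ ⊥))) ⟩
      blocks ⊤ ⊤ ⊤ ⊤
        ≡⟨ cong (λ p → ⊤̂ ++ (⊤̂ ++ p)) (⊤++⊤ (3 + k)) ⟩
      ⊤̂ ++ (⊤̂ ++ ⊤)
        ≡⟨ cong (⊤̂ ++_) (⊤++⊤ (3 + k)) ⟩
      ⊤̂ ++ ⊤
        ≡⟨ ⊤++⊤ (3 + k) ⟩
      ⊤ ∎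
      where
      open ≡-Reasoning
      full : {q : Subset (3 + k)} → q ≡ ⊤ → s₁ ∪ q ≡ ⊤
      full refl = ∪-zeroʳ s₁
      blocks-cong : ∀ {a b c d a′ b′ c′ d′} → a ≡ a′ → b ≡ b′ → c ≡ c′ → d ≡ d′ →
                    blocks a b c d ≡ blocks a′ b′ c′ d′
      blocks-cong refl refl refl refl = refl

  crown-isCrown′ : (3≤r : 3 ≤ 3 + k) → IsCrown (3 + k) (crown (3 + k) 3≤r)
  crown-isCrown′ 3≤r = record
    { base = base ; leg₁ = leg₁ ; leg₂ = leg₂ ; leg₃ = leg₃
    ; edges≡  = refl
    ; uniform = λ e → All.lookup {P = λ e → ∣ e ∣ ≡ 3 + k} (∣base∣ ∷ ∣leg₁∣ ∷ ∣leg₂∣ ∷ ∣leg₃∣ ∷ [])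
    ; linear  = linearFromPairs (crown (3 + k) 3≤r)
        ((ℕ.≤-reflexive m₁ ∷ ℕ.≤-reflexive m₂ ∷ ℕ.≤-reflexive m₃ ∷ [])
         ∷ (≤1 d₁₂ ∷ ≤1 d₁₃ ∷ []) ∷ (≤1 d₂₃ ∷ []) ∷ [] ∷ [])
    ; disj₁₂ = d₁₂ ; disj₁₃ = d₁₃ ; disj₂₃ = d₂₃
    ; meets₁ = m₁ ; meets₂ = m₂ ; meets₃ = m₃
    ; covers = covered
    }

crown-isCrown : (r : ℕ) (3≤r : 3 ≤ r) → IsCrown r (crown r 3≤r)
crown-isCrown (suc (suc (suc k))) 3≤r = crown-isCrown′ k 3≤r
crown-isCrown 1 (s≤s ())
crown-isCrown 2 (s≤s (s≤s ()))

{-# OPTIONS --safe #-}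
-- Give each edge, from each of its vertices, a weight depending on the degree d of the vertex
-- and at most 1/d, so that a vertex spends at most 1.  If an edge contains vertices of
-- degrees ≥ 2, ≥ r + 1 and ≥ 2r, then three disjoint legs can be chosen greedily, which gives a
-- crown.  So in a crown-free hypergraph either all degrees in the edge are at most 2r − 1, or all
-- but one are at most r, or some degree is 1; in each case it receives at least r / (2r − 1).
-- The weights are scaled by r (2r − 1) and rounded down to a step function of d.
module Submission where

open import Data.Bool using (true; false; if_then_else_)
open import Data.Fin using (Fin; zero; suc; _↑ˡ_; _↑ʳ_; splitAt; join)
import Data.Fin.Properties as Fin
open import Data.Fin.Subset
  using (Subset; inside; outside; _∈_; _∉_; _⊆_; Nonempty; _∩_; _∪_; _-_; ∣_∣; ⁅_⁆; ⊤; ⊥)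
open import Data.Fin.Subset.Properties
open import Data.Integer using (+_; +≤+) renaming (_≤_ to _≤ℤ_)
import Data.Integer.Properties as ℤ
open import Data.List using (List; []; _∷_; length; filter)
open import Data.List.Membership.Propositional using () renaming (_∈_ to _∈ˡ_)
open import Data.List.Membership.Propositional.Properties using (∈-filter⁻)
open import Data.List.Relation.Unary.All as All using (_∷_)
open import Data.List.Relation.Unary.AllPairs using ([]; _∷_)
open import Data.List.Relation.Unary.Any using (here; there)
open import Data.List.Relation.Unary.Unique.Propositional using (Unique)
import Data.List.Relation.Unary.Unique.Propositional.Properties as Unique
open import Data.Nat using (ℕ; NonZero; zero; suc; _+_; _*_; _∸_; _<_; z≤n; s≤s; s≤s⁻¹; _≤?_; _<?_)
  renaming (_≤_ to _≤ℕ_)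
import Data.Nat.Properties as ℕ
open import Data.Nat.Tactic.RingSolver using (solve-∀)
open import Data.Product using (∃-syntax; _×_; _,_; proj₁; proj₂)
open import Data.Rational using (_/_; _≤_)
import Data.Rational.Properties as ℚ
open import Data.Rational.Unnormalised using (mkℚᵘ; *≤*)
import Data.Rational.Unnormalised.Properties as ℚᵘ
open import Data.Sum using (_⊎_; inj₁; inj₂; [_,_]; [_,_]′)
open import Data.Vec using ([]; _∷_; _++_; here; there)
import Data.Vec.Properties as Vec
open import Data.Vec.Functional using () renaming (_++_ to _++ᶠ_; _∷_ to _∷ᶠ_)
import Data.Vec.Functional.Properties as Functional
open import Function using (_∘_; Injective)
open import Relation.Binary.PropositionalEquality hiding ([_])
open import Relation.Nullary using (yes; no; does; contradiction)
open import Relation.Nullary.Decidable using (dec-true; _×-dec_)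

open import Algebra.Properties.CommutativeMonoid.Sum ℕ.+-0-commutativeMonoid
  using (sum; sum-syntax; ∑-distrib-+; sum-cong-≗)
open import Defs

private
  variable
    k l m n : ℕ

-- Disjointness and cardinality of subsets.

Disjoint : Subset n → Subset n → Set
Disjoint p q = ∀ {x} → x ∈ p → x ∉ q

Disjoint-sym : {p q : Subset n} → Disjoint p q → Disjoint q p
Disjoint-sym p#q x∈q x∈p = p#q x∈p x∈q

Disjoint-∪ : {p q r : Subset n} → Disjoint p q → Disjoint p r → Disjoint p (q ∪ r)
Disjoint-∪ {q = q} {r} p#q p#r x∈p x∈q∪r = [ p#q x∈p , p#r x∈p ] (x∈p∪q⁻ q r x∈q∪r)

x∉p-x : (p : Subset n) (x : Fin n) → x ∉ p - x
x∉p-x (_ ∷ p) zero    ()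
x∉p-x (_ ∷ p) (suc x) (there x∈) = x∉p-x p x x∈

p-x⊆p : (p : Subset n) (x : Fin n) → p - x ⊆ p
p-x⊆p p x = p─q⊆p p ⁅ x ⁆

x∈p-y⇒x≢y : (p : Subset n) {x y : Fin n} → x ∈ p - y → x ≢ y
x∈p-y⇒x≢y p x∈p-x refl = x∉p-x p _ x∈p-x

1+∣p-x∣≡∣p∣ : {p : Subset n} {x : Fin n} → x ∈ p → suc ∣ p - x ∣ ≡ ∣ p ∣
1+∣p-x∣≡∣p∣ {p = _ ∷ p}       here       = cong (suc ∘ ∣_∣) (p─⊥≡p p)
1+∣p-x∣≡∣p∣ {p = inside ∷ p}  (there x∈) = cong suc (1+∣p-x∣≡∣p∣ x∈)
1+∣p-x∣≡∣p∣ {p = outside ∷ p} (there x∈) = 1+∣p-x∣≡∣p∣ x∈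

∣p-x∣≡k : {p : Subset n} {x : Fin n} → x ∈ p → ∣ p ∣ ≡ suc k → ∣ p - x ∣ ≡ k
∣p-x∣≡k x∈p eq = ℕ.suc-injective (trans (1+∣p-x∣≡∣p∣ x∈p) eq)

⁅x⁆∪[p-x]≡p : {p : Subset n} {x : Fin n} → x ∈ p → ⁅ x ⁆ ∪ (p - x) ≡ p
⁅x⁆∪[p-x]≡p {p = p} {x} x∈p = ⊆-antisym to from
  where
  to : ⁅ x ⁆ ∪ (p - x) ⊆ p
  to y∈ with x∈p∪q⁻ ⁅ x ⁆ (p - x) y∈
  ... | inj₁ y∈x   = subst (_∈ p) (sym (x∈⁅y⁆⇒x≡y x y∈x)) x∈p
  ... | inj₂ y∈p-x = p-x⊆p p x y∈p-x
  from : p ⊆ ⁅ x ⁆ ∪ (p - x)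
  from {y} y∈p with y Fin.≟ x
  ... | yes refl = x∈p∪q⁺ (inj₁ (x∈⁅x⁆ x))
  ... | no y≢x   = x∈p∪q⁺ (inj₂ (x∈p∧x≢y⇒x∈p-y y∈p y≢x))

∣p∪q∣≤∣p∣+∣q∣ : (p q : Subset n) → ∣ p ∪ q ∣ ≤ℕ ∣ p ∣ + ∣ q ∣
∣p∪q∣≤∣p∣+∣q∣ []            []            = z≤n
∣p∪q∣≤∣p∣+∣q∣ (outside ∷ p) (outside ∷ q) = ∣p∪q∣≤∣p∣+∣q∣ p q
∣p∪q∣≤∣p∣+∣q∣ (outside ∷ p) (inside ∷ q)  =
  ℕ.≤-trans (s≤s (∣p∪q∣≤∣p∣+∣q∣ p q)) (ℕ.≤-reflexive (sym (ℕ.+-suc ∣ p ∣ ∣ q ∣)))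
∣p∪q∣≤∣p∣+∣q∣ (inside ∷ p)  (outside ∷ q) = s≤s (∣p∪q∣≤∣p∣+∣q∣ p q)
∣p∪q∣≤∣p∣+∣q∣ (inside ∷ p)  (inside ∷ q)  =
  s≤s (ℕ.≤-trans (∣p∪q∣≤∣p∣+∣q∣ p q) (ℕ.+-monoʳ-≤ ∣ p ∣ (ℕ.n≤1+n ∣ q ∣)))

∣p∣≡1+k⇒Nonempty : {p : Subset n} → ∣ p ∣ ≡ suc k → Nonempty p
∣p∣≡1+k⇒Nonempty {n = n} {p = p} eq with nonempty? p
... | yes ne = ne
... | no ¬ne with () ← trans (sym eq) (trans (cong ∣_∣ (Empty-unique ¬ne)) (∣⊥∣≡0 n))

1<∣p∣ : {p : Subset n} {x y : Fin n} → x ∈ p → y ∈ p → x ≢ y → 1 < ∣ p ∣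
1<∣p∣ {p = p} {x} {y} x∈p y∈p x≢y =
  subst (1 <_) (1+∣p-x∣≡∣p∣ x∈p)
    (s≤s (subst (0 <_) (1+∣p-x∣≡∣p∣ (x∈p∧x≢y⇒x∈p-y y∈p (x≢y ∘ sym))) (s≤s z≤n)))

-- Block subsets, images and enumerations.

∈-++⁺ˡ : {p : Subset m} {q : Subset n} {i : Fin m} → i ∈ p → i ↑ˡ n ∈ p ++ q
∈-++⁺ˡ here       = here
∈-++⁺ˡ (there i∈) = there (∈-++⁺ˡ i∈)

∈-++⁺ʳ : (p : Subset m) {q : Subset n} {j : Fin n} → j ∈ q → m ↑ʳ j ∈ p ++ q
∈-++⁺ʳ []      j∈ = j∈
∈-++⁺ʳ (_ ∷ p) j∈ = there (∈-++⁺ʳ p j∈)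

∈-++⁻ : (p : Subset m) (q : Subset n) {x : Fin (m + n)} → x ∈ p ++ q →
        (∃[ i ] i ∈ p × i ↑ˡ n ≡ x) ⊎ (∃[ j ] j ∈ q × m ↑ʳ j ≡ x)
∈-++⁻ []      q x∈   = inj₂ (_ , x∈ , refl)
∈-++⁻ (_ ∷ p) q here = inj₁ (zero , here , refl)
∈-++⁻ (_ ∷ p) q (there x∈) with ∈-++⁻ p q x∈
... | inj₁ (i , i∈p , refl) = inj₁ (suc i , there i∈p , refl)
... | inj₂ (j , j∈q , refl) = inj₂ (j , j∈q , refl)

∈-image⁺ : (f : Fin m → Fin n) {p : Subset m} {u : Fin m} → u ∈ p → f u ∈ image f p
∈-image⁺ f {p} {u} u∈p = Vec.lookup⇒[]= (f u) (image f p)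
  (trans (Vec.lookup∘tabulate _ (f u)) (dec-true (hit? f p (f u)) (u , u∈p , refl)))

∈-image⁻ : (f : Fin m → Fin n) {p : Subset m} {v : Fin n} → v ∈ image f p →
           ∃[ u ] u ∈ p × f u ≡ v
∈-image⁻ f {p} {v} v∈ with hit? f p v | trans (sym (Vec.lookup∘tabulate _ v)) (Vec.[]=⇒lookup v∈)
... | yes hit | _ = hit
... | no _    | ()

image-⊥ : (f : Fin m → Fin n) → image f ⊥ ≡ ⊥
image-⊥ f = Empty-unique λ (_ , v∈) → ∉⊥ (proj₁ (proj₂ (∈-image⁻ f v∈)))

image-⁅⁆ : (f : Fin m → Fin n) (u : Fin m) → image f ⁅ u ⁆ ≡ ⁅ f u ⁆
image-⁅⁆ f u = ⊆-antisym to from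
  where
  to : image f ⁅ u ⁆ ⊆ ⁅ f u ⁆
  to v∈ with w , w∈ , refl ← ∈-image⁻ f v∈ with refl ← x∈⁅y⁆⇒x≡y u w∈ = x∈⁅x⁆ (f u)
  from : ⁅ f u ⁆ ⊆ image f ⁅ u ⁆
  from v∈ with refl ← x∈⁅y⁆⇒x≡y (f u) v∈ = ∈-image⁺ f (x∈⁅x⁆ u)

-- The edges of `crown` are concatenated blocks, so their images can be computed one block at a
-- time.
image-++ : (f : Fin l → Fin n) (g : Fin m → Fin n) (p : Subset l) (q : Subset m) →
           image (f ++ᶠ g) (p ++ q) ≡ image f p ∪ image g q
image-++ {l} {m = m} f g p q = ⊆-antisym to from
  where
  to : image (f ++ᶠ g) (p ++ q) ⊆ image f p ∪ image g q
  to v∈ with u , u∈ , refl ← ∈-image⁻ (f ++ᶠ g) v∈ with ∈-++⁻ p q u∈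
  ... | inj₁ (i , i∈p , refl) = x∈p∪q⁺ (inj₁
    (subst (_∈ image f p) (sym (Functional.lookup-++ˡ f g i)) (∈-image⁺ f i∈p)))
  ... | inj₂ (j , j∈q , refl) = x∈p∪q⁺ (inj₂
    (subst (_∈ image g q) (sym (Functional.lookup-++ʳ f g j)) (∈-image⁺ g j∈q)))
  from : image f p ∪ image g q ⊆ image (f ++ᶠ g) (p ++ q)
  from v∈ with x∈p∪q⁻ (image f p) (image g q) v∈
  ... | inj₁ v∈f with i , i∈p , refl ← ∈-image⁻ f v∈f =
    subst (_∈ image (f ++ᶠ g) (p ++ q)) (Functional.lookup-++ˡ f g i)
      (∈-image⁺ (f ++ᶠ g) (∈-++⁺ˡ i∈p))
  ... | inj₂ v∈g with j , j∈q , refl ← ∈-image⁻ g v∈g =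
    subst (_∈ image (f ++ᶠ g) (p ++ q)) (Functional.lookup-++ʳ f g j)
      (∈-image⁺ (f ++ᶠ g) (∈-++⁺ʳ p j∈q))

-- `injective` serves the embedding, while `sound` and `complete` together make the image of `⊤`
-- exactly `p`.
record _Enumerates_ (f : Fin m → Fin n) (p : Subset n) : Set where
  field
    injective : Injective _≡_ _≡_ f
    sound     : ∀ u → f u ∈ p
    complete  : ∀ {v} → v ∈ p → ∃[ u ] f u ≡ v

open _Enumerates_

image-⊤ : {f : Fin m → Fin n} {p : Subset n} → f Enumerates p → image f ⊤ ≡ p
image-⊤ {f = f} {p} enum = ⊆-antisym to from
  where
  to : image f ⊤ ⊆ p
  to v∈ with u , _ , refl ← ∈-image⁻ f v∈ = sound enum u
  from : p ⊆ image f ⊤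
  from v∈ with u , refl ← complete enum v∈ = ∈-image⁺ f ∈⊤

enumeration : (p : Subset n) → ∃[ f ] _Enumerates_ {∣ p ∣} f p
enumeration [] = (λ ()) , record { injective = λ {} ; sound = λ () ; complete = λ () }
enumeration (outside ∷ p) with f , enum ← enumeration p = suc ∘ f , record
  { injective = injective enum ∘ Fin.suc-injective
  ; sound     = there ∘ sound enum
  ; complete  = λ { (there v∈) → let u , eq = complete enum v∈ in u , cong suc eq }
  }
enumeration (inside ∷ p) with f , enum ← enumeration p = zero ∷ᶠ (suc ∘ f) , record
  { injective = λ { {zero}  {zero}  _  → refl
                  ; {suc _} {suc _} eq → cong suc (injective enum (Fin.suc-injective eq)) }
  ; sound     = λ { zero → here ; (suc u) → there (sound enum u) }
  ; complete  = λ where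
      here       → zero , refl
      (there v∈) → let u , eq = complete enum v∈ in suc u , cong suc eq
  }

∷-enumerates : {f : Fin m → Fin n} {p : Subset n} {x : Fin n} → x ∈ p → f Enumerates (p - x) →
               (x ∷ᶠ f) Enumerates p
∷-enumerates {p = p} {x} x∈p enum = record
  { injective = λ { {zero}  {zero}  _  → refl
                  ; {suc _} {suc _} eq → cong suc (injective enum eq)
                  ; {zero}  {suc u} eq → contradiction (sym eq) (x∈p-y⇒x≢y p (sound enum u))
                  ; {suc u} {zero}  eq → contradiction eq (x∈p-y⇒x≢y p (sound enum u)) }
  ; sound     = λ { zero → x∈p ; (suc u) → p-x⊆p p x (sound enum u) }
  ; complete  = λ {v} v∈p → case v v∈p
  }
  where
  case : ∀ v → v ∈ p → ∃[ u ] (x ∷ᶠ _) u ≡ v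
  case v v∈p with v Fin.≟ x
  ... | yes refl = zero , refl
  ... | no v≢x   = let u , eq = complete enum (x∈p∧x≢y⇒x∈p-y v∈p v≢x) in suc u , eq

++-enumerates : {f : Fin l → Fin n} {g : Fin m → Fin n} {p q : Subset n} →
                f Enumerates p → g Enumerates q → Disjoint p q → (f ++ᶠ g) Enumerates (p ∪ q)
++-enumerates {l} {m = m} {f} {g} {p} {q} fp gq p#q = record
  -- `(f ++ᶠ g) x` unfolds to `[ f , g ] (splitAt l x)`, and `join` undoes `splitAt`. Disjointness
  -- of `p` and `q` excludes the mixed cases.
  { injective = λ {x} {y} eq → trans (sym (Fin.join-splitAt l m x))
      (trans (cong (join l m) ([]-injective (splitAt l x) (splitAt l y) eq)) (Fin.join-splitAt l m y))
  ; sound     = λ x → []-sound (splitAt l x)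
  ; complete  = λ v∈ → [ (λ v∈p → let u , eq = complete fp v∈p in
                                  u ↑ˡ m , trans (Functional.lookup-++ˡ f g u) eq)
                       , (λ v∈q → let u , eq = complete gq v∈q in
                                  l ↑ʳ u , trans (Functional.lookup-++ʳ f g u) eq)
                       ] (x∈p∪q⁻ p q v∈)
  }
  where
  []-injective : ∀ s t → [ f , g ] s ≡ [ f , g ] t → s ≡ t
  []-injective (inj₁ i) (inj₁ j) eq = cong inj₁ (injective fp eq)
  []-injective (inj₂ i) (inj₂ j) eq = cong inj₂ (injective gq eq)
  []-injective (inj₁ i) (inj₂ j) eq =
    contradiction (subst (_∈ q) (sym eq) (sound gq j)) (p#q (sound fp i))
  []-injective (inj₂ i) (inj₁ j) eq =
    contradiction (subst (_∈ q) eq (sound gq i)) (p#q (sound fp j))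
  []-sound : ∀ s → [ f , g ] s ∈ p ∪ q
  []-sound (inj₁ i) = x∈p∪q⁺ (inj₁ (sound fp i))
  []-sound (inj₂ j) = x∈p∪q⁺ (inj₂ (sound gq j))

enumerationOfSize : (p : Subset n) → ∣ p ∣ ≡ k → ∃[ f ] _Enumerates_ {k} f p
enumerationOfSize p refl = enumeration p

-- In `crown` the base passes through the vertex `zero` of each leg, so the point shared with the
-- base has to come first.
rootedEnumeration : {p : Subset n} {x : Fin n} → x ∈ p → ∣ p ∣ ≡ suc k →
                    ∃[ f ] _Enumerates_ {suc k} f p × f zero ≡ x
rootedEnumeration {p = p} {x} x∈p eq =
  let f , enum = enumerationOfSize (p - x) (∣p-x∣≡k x∈p eq)
  in  x ∷ᶠ f , ∷-enumerates x∈p enum , refl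

-- Linearity and the embedding of a crown.

linear⇒≡ : (H : Hypergraph n) → Linear H → {e f : Subset n} → e ∈ˡ edges H → f ∈ˡ edges H →
           {x y : Fin n} → x ≢ y → x ∈ e → y ∈ e → x ∈ f → y ∈ f → e ≡ f
linear⇒≡ H lin {e} {f} e∈ f∈ x≢y x∈e y∈e x∈f y∈f with e ≟ˢ f
... | yes e≡f = e≡f
... | no e≢f  = contradiction
  (ℕ.≤-trans (1<∣p∣ (x∈p∩q⁺ (x∈e , x∈f)) (x∈p∩q⁺ (y∈e , y∈f)) x≢y) (lin e f e∈ f∈ e≢f))
  (λ { (s≤s ()) })

-- Disjointness of the legs forces the roots `a`, `b`, `c` to be distinct, and linearity keeps the
-- other `k` points of `e` off the legs. Enumerating each leg from its root, and then those `k`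
-- points, gives the embedding.
crown⊆ : ∀ k (H : Hypergraph n) → Uniform (3 + k) H → Linear H →
         {e f g h : Subset n} → e ∈ˡ edges H → f ∈ˡ edges H → g ∈ˡ edges H → h ∈ˡ edges H →
         Disjoint f g → Disjoint f h → Disjoint g h →
         {a b c : Fin n} → a ∈ e → b ∈ e → c ∈ e → a ∈ f → b ∈ g → c ∈ h →
         (3≤r : 3 ≤ℕ 3 + k) → Contains H (crown (3 + k) 3≤r)
crown⊆ {n} k H unif lin {e} {f} {g} {h} e∈ f∈ g∈ h∈ f#g f#h g#h {a} {b} {c}
       a∈e b∈e c∈e a∈f b∈g c∈h 3≤r
  = φ , injective φ-enum , preserves
  where
  open Crown k

  b∈e-a : b ∈ e - a
  b∈e-a = x∈p∧x≢y⇒x∈p-y b∈e λ { refl → f#g a∈f b∈g }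

  c∈e-a-b : c ∈ e - a - b
  c∈e-a-b = x∈p∧x≢y⇒x∈p-y (x∈p∧x≢y⇒x∈p-y c∈e λ { refl → f#h a∈f c∈h })
                           λ { refl → g#h b∈g c∈h }

  rest : Subset n
  rest = e - a - b - c

  -- `y`, the root of another leg, lies in `e` but not in `p`, so `p` is not `e`; a common point
  -- other than `x` would make them equal.
  leg#rest : ∀ {p x y} → p ∈ˡ edges H → x ∈ e → x ∈ p → y ∈ e → y ∉ p → Disjoint p (e - x)
  leg#rest {p} {x} {y} p∈ x∈e x∈p y∈e y∉p v∈p v∈e-x = y∉p (subst (y ∈_) e≡p y∈e)
    where
    e≡p : e ≡ p
    e≡p = linear⇒≡ H lin e∈ p∈ (x∈p-y⇒x≢y e v∈e-x) (p-x⊆p e x v∈e-x) x∈e v∈p x∈p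

  rest⊆-a : rest ⊆ e - a
  rest⊆-a = p-x⊆p (e - a) b ∘ p-x⊆p (e - a - b) c

  rest⊆-b : rest ⊆ e - b
  rest⊆-b v∈ = x∈p∧x≢y⇒x∈p-y (p-x⊆p e a (rest⊆-a v∈)) (x∈p-y⇒x≢y (e - a) (p-x⊆p (e - a - b) c v∈))

  rest⊆-c : rest ⊆ e - c
  rest⊆-c v∈ = x∈p∧x≢y⇒x∈p-y (p-x⊆p e a (rest⊆-a v∈)) (x∈p-y⇒x≢y (e - a - b) v∈)

  f#rest : Disjoint f rest
  f#rest v∈ = leg#rest f∈ a∈e a∈f b∈e (λ b∈f → f#g b∈f b∈g) v∈ ∘ rest⊆-a

  g#rest : Disjoint g rest
  g#rest v∈ = leg#rest g∈ b∈e b∈g a∈e (f#g a∈f) v∈ ∘ rest⊆-b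

  h#rest : Disjoint h rest
  h#rest v∈ = leg#rest h∈ c∈e c∈h a∈e (f#h a∈f) v∈ ∘ rest⊆-c

  f-enum : ∃[ f₁ ] _Enumerates_ {3 + k} f₁ f × f₁ zero ≡ a
  f-enum = rootedEnumeration a∈f (unif f f∈)

  g-enum : ∃[ g₁ ] _Enumerates_ {3 + k} g₁ g × g₁ zero ≡ b
  g-enum = rootedEnumeration b∈g (unif g g∈)

  h-enum : ∃[ h₁ ] _Enumerates_ {3 + k} h₁ h × h₁ zero ≡ c
  h-enum = rootedEnumeration c∈h (unif h h∈)

  rest-enum : ∃[ e₁ ] _Enumerates_ {k} e₁ rest
  rest-enum = enumerationOfSize rest (∣p-x∣≡k c∈e-a-b (∣p-x∣≡k b∈e-a (∣p-x∣≡k a∈e (unif e e∈))))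

  f₁ g₁ h₁ : Fin (3 + k) → Fin n
  f₁ = proj₁ f-enum
  g₁ = proj₁ g-enum
  h₁ = proj₁ h-enum

  e₁ : Fin k → Fin n
  e₁ = proj₁ rest-enum

  φ : Fin Vertices → Fin n
  φ = f₁ ++ᶠ (g₁ ++ᶠ (h₁ ++ᶠ e₁))

  φ-enum : φ Enumerates (f ∪ (g ∪ (h ∪ rest)))
  φ-enum = ++-enumerates (proj₁ (proj₂ f-enum))
    (++-enumerates (proj₁ (proj₂ g-enum))
      (++-enumerates (proj₁ (proj₂ h-enum)) (proj₂ rest-enum) h#rest)
      (Disjoint-∪ g#h g#rest))
    (Disjoint-∪ f#g (Disjoint-∪ f#h f#rest))

  image-φ : ∀ p q r s {p′ q′ r′ s′} →
            image f₁ p ≡ p′ → image g₁ q ≡ q′ → image h₁ r ≡ r′ → image e₁ s ≡ s′ →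
            image φ (blocks p q r s) ≡ p′ ∪ (q′ ∪ (r′ ∪ s′))
  image-φ p q r s refl refl refl refl =
    trans (image-++ f₁ _ p _) (cong (image f₁ p ∪_)
      (trans (image-++ g₁ _ q _) (cong (image g₁ q ∪_) (image-++ h₁ e₁ r s))))

  image-leg₁ : image φ leg₁ ≡ f
  image-leg₁ = trans
    (image-φ ⊤ ⊥ ⊥ ⊥ (image-⊤ (proj₁ (proj₂ f-enum))) (image-⊥ g₁) (image-⊥ h₁) (image-⊥ e₁))
    (trans (cong (f ∪_) (trans (∪-identityˡ _) (∪-identityˡ _))) (∪-identityʳ f))

  image-leg₂ : image φ leg₂ ≡ g
  image-leg₂ = trans
    (image-φ ⊥ ⊤ ⊥ ⊥ (image-⊥ f₁) (image-⊤ (proj₁ (proj₂ g-enum))) (image-⊥ h₁) (image-⊥ e₁))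
    (trans (∪-identityˡ _) (trans (cong (g ∪_) (∪-identityˡ _)) (∪-identityʳ g)))

  image-leg₃ : image φ leg₃ ≡ h
  image-leg₃ = trans
    (image-φ ⊥ ⊥ ⊤ ⊥ (image-⊥ f₁) (image-⊥ g₁) (image-⊤ (proj₁ (proj₂ h-enum))) (image-⊥ e₁))
    (trans (∪-identityˡ _) (trans (∪-identityˡ _) (∪-identityʳ h)))

  image-base : image φ base ≡ e
  image-base = begin
    image φ base
      ≡⟨ image-φ ⁅ zero ⁆ ⁅ zero ⁆ ⁅ zero ⁆ ⊤
                 (root f₁ (proj₂ (proj₂ f-enum))) (root g₁ (proj₂ (proj₂ g-enum)))
                 (root h₁ (proj₂ (proj₂ h-enum))) (image-⊤ (proj₂ rest-enum)) ⟩
    -- The roots are put back in the reverse order of their removal from `e`.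
    ⁅ a ⁆ ∪ (⁅ b ⁆ ∪ (⁅ c ⁆ ∪ rest))    ≡⟨ cong (λ p → ⁅ a ⁆ ∪ (⁅ b ⁆ ∪ p)) (⁅x⁆∪[p-x]≡p c∈e-a-b) ⟩
    ⁅ a ⁆ ∪ (⁅ b ⁆ ∪ (e - a - b))       ≡⟨ cong (⁅ a ⁆ ∪_) (⁅x⁆∪[p-x]≡p b∈e-a) ⟩
    ⁅ a ⁆ ∪ (e - a)                     ≡⟨ ⁅x⁆∪[p-x]≡p a∈e ⟩
    e                                   ∎
    where
    open ≡-Reasoning
    root : (i : Fin (3 + k) → Fin n) {x : Fin n} → i zero ≡ x → image i ⁅ zero ⁆ ≡ ⁅ x ⁆
    root i refl = image-⁅⁆ i zero

  preserves : ∀ p → p ∈ˡ edges (crown (3 + k) 3≤r) → image φ p ∈ˡ edges H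
  preserves _ (here refl)                         = subst (_∈ˡ edges H) (sym image-base) e∈
  preserves _ (there (here refl))                 = subst (_∈ˡ edges H) (sym image-leg₁) f∈
  preserves _ (there (there (here refl)))         = subst (_∈ˡ edges H) (sym image-leg₂) g∈
  preserves _ (there (there (there (here refl)))) = subst (_∈ˡ edges H) (sym image-leg₃) h∈

-- Degrees and the greedy choice of legs.

star : Fin n → List (Subset n) → List (Subset n)
star v = filter (v ∈?_)

degree : List (Subset n) → Fin n → ℕ
degree es v = length (star v es)

-- Pigeonhole: if no two of the sets share a point of q, then at most ∣ q ∣ of them meet q.
missing : (es : List (Subset n)) (q : Subset n) → Unique es →
          (∀ {e f x} → e ∈ˡ es → f ∈ˡ es → x ∈ q → x ∈ e → x ∈ f → e ≡ f) →
          ∣ q ∣ < length es → ∃[ e ] e ∈ˡ es × Disjoint e q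
missing (e ∷ es) q (e∉es ∷ uniq) sep lt with nonempty? (e ∩ q)
... | no  e∩q=∅     = e , here refl , λ x∈e x∈q → e∩q=∅ (_ , x∈p∩q⁺ (x∈e , x∈q))
... | yes (x , x∈) with x∈e , x∈q ← x∈p∩q⁻ e q x∈ =
  -- No later set contains `x`, so `x` is dropped from `q` along with `e` from the list, and the
  -- strict inequality survives.
  let f , f∈ , f#q-x = missing es (q - x) uniq
        (λ e∈ f∈ → sep (there e∈) (there f∈) ∘ p-x⊆p q x)
        (ℕ.≤-trans (x∈p⇒∣p-x∣<∣p∣ x∈q) (s≤s⁻¹ lt))
  in  f , there f∈ , λ {y} y∈f y∈q → f#q-x y∈f (x∈p∧x≢y⇒x∈p-y y∈q λ { refl →
        All.lookup e∉es f∈ (sep (here refl) (there f∈) x∈q x∈e y∈f) })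

-- Two edges through `v` that share a point of `q` have two common points, since `v ∉ q`, and so
-- coincide. Hence the pigeonhole applies to the star of `v`.
edgeMissing : (H : Hypergraph n) → Linear H → {v : Fin n} {q : Subset n} → v ∉ q →
              ∣ q ∣ < degree (edges H) v → ∃[ e ] e ∈ˡ edges H × v ∈ e × Disjoint e q
edgeMissing H lin {v} {q} v∉q lt =
  let e , e∈ , e#q = missing (star v (edges H)) q (Unique.filter⁺ (v ∈?_) (unique H)) sep lt
      e∈H , v∈e    = ∈-filter⁻ (v ∈?_) e∈
  in  e , e∈H , v∈e , e#q
  where
  sep : ∀ {e f x} → e ∈ˡ star v (edges H) → f ∈ˡ star v (edges H) →
        x ∈ q → x ∈ e → x ∈ f → e ≡ f
  sep e∈ f∈ x∈q x∈e x∈f =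
    let e∈H , v∈e = ∈-filter⁻ (v ∈?_) e∈
        f∈H , v∈f = ∈-filter⁻ (v ∈?_) f∈
    in  linear⇒≡ H lin e∈H f∈H (λ { refl → v∉q x∈q }) x∈e v∈e x∈f v∈f

-- The legs are chosen greedily at a, b, c in this order.  A leg that misses a point of e
-- is not e; the root b is left out of the set that the third leg must avoid, since an edge
-- through b and c is e, which meets the first leg.  This is what saves the 1 in 2r − 1.
highDegree⇒crown : ∀ k (H : Hypergraph n) → Uniform (3 + k) H → Linear H →
                   {e : Subset n} → e ∈ˡ edges H →
                   {a b c : Fin n} → a ∈ e → b ∈ e → c ∈ e → a ≢ b → a ≢ c → b ≢ c →
                   1 < degree (edges H) a → 3 + k < degree (edges H) b →
                   (3 + k) + (2 + k) < degree (edges H) c →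
                   (3≤r : 3 ≤ℕ 3 + k) → Contains H (crown (3 + k) 3≤r)
highDegree⇒crown k H unif lin {e} e∈ {a} {b} {c} a∈e b∈e c∈e a≢b a≢c b≢c da db dc 3≤r =
  let f , f∈ , a∈f , f#b = edgeMissing H lin {q = ⁅ b ⁆} (x≢y⇒x∉⁅y⁆ a≢b)
        (subst (_< degree (edges H) a) (sym (∣⁅x⁆∣≡1 b)) da)
      f∩e : ∀ {x} → x ∈ e → a ≢ x → x ∉ f
      f∩e x∈e a≢x x∈f = f#b
        (subst (b ∈_) (linear⇒≡ H lin e∈ f∈ a≢x a∈e x∈e a∈f x∈f) b∈e) (x∈⁅x⁆ b)
      g , g∈ , b∈g , g#f = edgeMissing H lin {q = f} (f∩e b∈e a≢b)
        (subst (_< degree (edges H) b) (sym (unif f f∈)) db)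
      c∉g : c ∉ g
      c∉g c∈g = g#f (subst (a ∈_) (linear⇒≡ H lin e∈ g∈ b≢c b∈e c∈e b∈g c∈g) a∈e) a∈f
      h , h∈ , c∈h , h#f∪g-b = edgeMissing H lin {q = f ∪ (g - b)}
        (λ c∈ → [ f∩e c∈e a≢c , c∉g ∘ p-x⊆p g b ]′ (x∈p∪q⁻ f (g - b) c∈))
        (ℕ.≤-<-trans (∣p∪q∣≤∣p∣+∣q∣ f (g - b))
          (subst (_< degree (edges H) c) (sym (cong₂ _+_ (unif f f∈) (∣p-x∣≡k b∈g (unif g g∈)))) dc))
      h#f : Disjoint h f
      h#f x∈h x∈f = h#f∪g-b x∈h (x∈p∪q⁺ (inj₁ x∈f))
      b∉h : b ∉ h
      b∉h b∈h = h#f (subst (a ∈_) (linear⇒≡ H lin e∈ h∈ b≢c b∈e c∈e b∈h c∈h) a∈e) a∈f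
      h#g : Disjoint h g
      h#g x∈h x∈g = h#f∪g-b x∈h (x∈p∪q⁺ (inj₂ (x∈p∧x≢y⇒x∈p-y x∈g λ { refl → b∉h x∈h })))
  in  crown⊆ k H unif lin e∈ f∈ g∈ h∈ (Disjoint-sym g#f) (Disjoint-sym h#f) (Disjoint-sym h#g)
        a∈e b∈e c∈e a∈f b∈g c∈h 3≤r

-- Weights of edges and double counting.

weight : (Fin n → ℕ) → Subset n → ℕ
weight {n} w p = ∑[ v < n ] (if does (v ∈? p) then w v else 0)

∣p∣*c≤weight : {w : Fin n → ℕ} (c : ℕ) (p : Subset n) → (∀ {v} → v ∈ p → c ≤ℕ w v) →
               ∣ p ∣ * c ≤ℕ weight w p
∣p∣*c≤weight c []            c≤w = z≤n
∣p∣*c≤weight c (outside ∷ p) c≤w = ∣p∣*c≤weight c p (c≤w ∘ there)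
∣p∣*c≤weight c (inside ∷ p)  c≤w = ℕ.+-mono-≤ (c≤w here) (∣p∣*c≤weight c p (c≤w ∘ there))

weight-mono : (w : Fin n → ℕ) {p q : Subset n} → p ⊆ q → weight w p ≤ℕ weight w q
weight-mono w {[]}          {[]}          p⊆q = z≤n
weight-mono w {outside ∷ p} {outside ∷ q} p⊆q = weight-mono (w ∘ suc) (drop-∷-⊆ p⊆q)
weight-mono w {outside ∷ p} {inside ∷ q}  p⊆q =
  ℕ.≤-trans (weight-mono (w ∘ suc) (drop-∷-⊆ p⊆q)) (ℕ.m≤n+m _ (w zero))
weight-mono w {inside ∷ p}  {inside ∷ q}  p⊆q =
  ℕ.+-monoʳ-≤ (w zero) (weight-mono (w ∘ suc) (drop-∷-⊆ p⊆q))
weight-mono w {inside ∷ p}  {outside ∷ q} p⊆q with () ← p⊆q here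

w≤weight : (w : Fin n → ℕ) {p : Subset n} {v : Fin n} → v ∈ p → w v ≤ℕ weight w p
w≤weight w {p} {v} v∈p = begin
  w v                ≡⟨ ℕ.*-identityˡ (w v) ⟨
  1 * w v            ≡⟨ cong (_* w v) (∣⁅x⁆∣≡1 v) ⟨
  ∣ ⁅ v ⁆ ∣ * w v    ≤⟨ ∣p∣*c≤weight (w v) ⁅ v ⁆
                          (λ u∈ → ℕ.≤-reflexive (cong w (sym (x∈⁅y⁆⇒x≡y v u∈)))) ⟩
  weight w ⁅ v ⁆     ≤⟨ weight-mono w (λ u∈ → subst (_∈ p) (sym (x∈⁅y⁆⇒x≡y v u∈)) v∈p) ⟩
  weight w p         ∎
  where open ℕ.≤-Reasoning

-- Exchange of summation: putting `e` in front of the list raises by one the degrees of exactly its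
-- own vertices. As `weight` sums over all of `Fin n`, the contributions add vertex by vertex.
doubleCount : (w : Fin n → ℕ) (c : ℕ) (es : List (Subset n)) →
              (∀ {e} → e ∈ˡ es → c ≤ℕ weight w e) →
              length es * c ≤ℕ ∑[ v < n ] (degree es v * w v)
doubleCount w c []       c≤ = z≤n
doubleCount {n} w c (e ∷ es) c≤ = begin
  c + length es * c                           ≤⟨ ℕ.+-mono-≤ (c≤ (here refl))
                                                   (doubleCount w c es (c≤ ∘ there)) ⟩
  weight w e + ∑[ v < n ] (degree es v * w v) ≡⟨ ∑-distrib-+ _ (λ v → degree es v * w v) ⟨
  ∑[ v < n ] ((if does (v ∈? e) then w v else 0) + degree es v * w v)
                                              ≡⟨ sum-cong-≗ step ⟩
  ∑[ v < n ] (degree (e ∷ es) v * w v)        ∎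
  where
  open ℕ.≤-Reasoning
  step : ∀ v → (if does (v ∈? e) then w v else 0) + degree es v * w v ≡ degree (e ∷ es) v * w v
  -- The same Boolean decides the summand and whether `filter` keeps `e`, so both cases hold by
  -- computation.
  step v with does (v ∈? e)
  ... | true  = refl
  ... | false = refl

∑≤n*c : (t : Fin n → ℕ) (c : ℕ) → (∀ v → t v ≤ℕ c) → sum t ≤ℕ n * c
∑≤n*c {zero}  t c t≤c = z≤n
∑≤n*c {suc n} t c t≤c = ℕ.+-mono-≤ (t≤c zero) (∑≤n*c (t ∘ suc) c (t≤c ∘ suc))

-- A step function below r s / d; with s = 2r − 1 it is the weight that a vertex of degree d
-- gives to each of its edges.
share : (r s d : ℕ) → ℕ
share r s d with d ≤? 1 | d ≤? r | d ≤? s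
... | yes _ | _     | _     = r * s
... | no _  | yes _ | _     = s
... | no _  | no _  | yes _ = r
... | no _  | no _  | no _  = 0

-- The budget of a vertex. On each nonzero step the share is `r * s` divided by the threshold that
-- `d` has just passed, namely 1, `r` or `s`.
d*share≤r*s : ∀ r s d → d * share r s d ≤ℕ r * s
d*share≤r*s r s d with d ≤? 1 | d ≤? r | d ≤? s
... | yes d≤1 | _       | _       = ℕ.≤-trans (ℕ.*-monoˡ-≤ (r * s) d≤1) (ℕ.≤-reflexive (ℕ.*-identityˡ _))
... | no _    | yes d≤r | _       = ℕ.*-monoˡ-≤ s d≤r
... | no _    | no _    | yes d≤s = ℕ.≤-trans (ℕ.*-monoˡ-≤ r d≤s) (ℕ.≤-reflexive (ℕ.*-comm s r))
... | no _    | no _    | no _    = subst (_≤ℕ r * s) (sym (ℕ.*-zeroʳ d)) z≤n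

d≤1⇒r*s≤share : ∀ r s d → d ≤ℕ 1 → r * s ≤ℕ share r s d
d≤1⇒r*s≤share r s d d≤1 with d ≤? 1
... | yes _   = ℕ.≤-refl
... | no  d≰1 = contradiction d≤1 d≰1

-- If `d` already falls on the first step, the share is `r * s`, which dominates `s` because `r` is
-- nonzero.
d≤r⇒s≤share : ∀ r s d .{{_ : NonZero r}} → d ≤ℕ r → s ≤ℕ share r s d
d≤r⇒s≤share r s d d≤r with d ≤? 1 | d ≤? r
... | yes _ | _       = ℕ.m≤n*m s r
... | no _  | yes _   = ℕ.≤-refl
... | no _  | no  d≰r = contradiction d≤r d≰r

-- All three nonzero values dominate `r`: `r * s` because `s` is nonzero, and `s` by the hypothesis
-- `r ≤ s`.
d≤s⇒r≤share : ∀ r s d .{{_ : NonZero s}} → r ≤ℕ s → d ≤ℕ s → r ≤ℕ share r s d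
d≤s⇒r≤share r s d r≤s d≤s with d ≤? 1 | d ≤? r | d ≤? s
... | yes _ | _     | _       = ℕ.m≤m*n r s
... | no _  | yes _ | _       = r≤s
... | no _  | no _  | yes _   = ℕ.≤-refl
... | no _  | no _  | no  d≰s = contradiction d≤s d≰s

-- The weight received by each edge, and the bound on the size.

r*r≤[r-1]*s : ∀ k → (3 + k) * (3 + k) ≤ℕ (2 + k) * ((3 + k) + (2 + k))
r*r≤[r-1]*s k = subst ((3 + k) * (3 + k) ≤ℕ_) (identity k) (ℕ.m≤m+n _ _)
  where
  -- The added term is (r - 1)(2r - 1) - r² = r² - 3r + 1 written in `k`.
  identity : ∀ k → (3 + k) * (3 + k) + (1 + 3 * k + k * k) ≡ (2 + k) * ((3 + k) + (2 + k))
  identity = solve-∀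

-- Scaling by `r * s` turns r / (2r - 1) into `r * r`. The roots are sought from the largest
-- required degree downwards, and each failure bounds the remaining degrees.
r*r≤weight : ∀ k (3≤r : 3 ≤ℕ 3 + k) (H : Hypergraph n) → Admissible (3 + k) (crown (3 + k) 3≤r) H →
             {e : Subset n} → e ∈ˡ edges H →
             (3 + k) * (3 + k) ≤ℕ weight (share (3 + k) ((3 + k) + (2 + k)) ∘ degree (edges H)) e
r*r≤weight {n} k 3≤r H (admissible unif lin free) {e} e∈ = bound
  where
  open ℕ.≤-Reasoning
  r = 3 + k
  s = (3 + k) + (2 + k)
  d = degree (edges H)
  w = share r s ∘ d

  bound : r * r ≤ℕ weight w e
  bound with Fin.any? (λ c → (c ∈? e) ×-dec (s <? d c))
  -- All `r` vertices have degree at most `s` and give at least `r` each.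
  ... | no ¬c = begin
    r * r        ≡⟨ cong (_* r) (unif e e∈) ⟨
    ∣ e ∣ * r    ≤⟨ ∣p∣*c≤weight r e (λ {v} v∈ →
                      d≤s⇒r≤share r s (d v) (ℕ.m≤m+n r _) (ℕ.≮⇒≥ λ lt → ¬c (v , v∈ , lt))) ⟩
    weight w e   ∎
  ... | yes (c , c∈e , dc) with Fin.any? (λ b → (b ∈? e - c) ×-dec (r <? d b))
  -- `c` gives nothing, but the other r - 1 vertices have degree at most `r` and give at least `s`
  -- each.
  ...   | no ¬b = begin
    r * r            ≤⟨ r*r≤[r-1]*s k ⟩
    (2 + k) * s      ≡⟨ cong (_* s) (∣p-x∣≡k c∈e (unif e e∈)) ⟨
    ∣ e - c ∣ * s    ≤⟨ ∣p∣*c≤weight s (e - c) (λ {v} v∈ →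
                          d≤r⇒s≤share r s (d v) (ℕ.≮⇒≥ λ lt → ¬b (v , v∈ , lt))) ⟩
    weight w (e - c) ≤⟨ weight-mono w (p-x⊆p e c) ⟩
    weight w e       ∎
  ...   | yes (b , b∈e-c , db)
    -- As r ≥ 3, a point of `e` is left besides `b` and `c`; any such point serves as `a`.
    with a , a∈ ← ∣p∣≡1+k⇒Nonempty (∣p-x∣≡k b∈e-c (∣p-x∣≡k c∈e (unif e e∈)))
    with d a ≤? 1
  -- A single vertex of degree at most 1 gives `r * s`, which suffices alone.
  ...     | yes da = begin
    r * r        ≤⟨ ℕ.*-monoʳ-≤ r (ℕ.m≤m+n r _) ⟩
    r * s        ≤⟨ d≤1⇒r*s≤share r s (d a) da ⟩
    w a          ≤⟨ w≤weight w (p-x⊆p e c (p-x⊆p (e - c) b a∈)) ⟩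
    weight w e   ∎
  ...     | no ¬da = contradiction
    (highDegree⇒crown k H unif lin e∈
      (p-x⊆p e c (p-x⊆p (e - c) b a∈)) (p-x⊆p e c b∈e-c) c∈e
      (x∈p-y⇒x≢y (e - c) a∈) (x∈p-y⇒x≢y e (p-x⊆p (e - c) b a∈)) (x∈p-y⇒x≢y e b∈e-c)
      (ℕ.≰⇒> ¬da) db dc 3≤r)
    free

-- Each edge receives at least `r * r` and each vertex gives at most `r * s` in all; one factor `r`,
-- an artefact of the scaling, cancels.
size-bound : ∀ k (3≤r : 3 ≤ℕ 3 + k) (H : Hypergraph n) → Admissible (3 + k) (crown (3 + k) 3≤r) H →
             size H * (3 + k) ≤ℕ ((3 + k) + (2 + k)) * n
size-bound {n} k 3≤r H adm = ℕ.*-cancelʳ-≤ _ _ r (begin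
  size H * r * r                       ≡⟨ ℕ.*-assoc (size H) r r ⟩
  size H * (r * r)                     ≤⟨ doubleCount (share r s ∘ d) (r * r) (edges H)
                                            (r*r≤weight k 3≤r H adm) ⟩
  ∑[ v < n ] (d v * share r s (d v))   ≤⟨ ∑≤n*c _ (r * s) (d*share≤r*s r s ∘ d) ⟩
  n * (r * s)                          ≡⟨ rearrange n r s ⟩
  s * n * r                            ∎)
  where
  open ℕ.≤-Reasoning
  r = 3 + k
  s = (3 + k) + (2 + k)
  d = degree (edges H)
  rearrange : ∀ n r s → n * (r * s) ≡ s * n * r
  rearrange = solve-∀

-- Passage to rational numbers.

m*r≤p⇒m/1≤p/r : ∀ m p r .{{_ : NonZero r}} → m * r ≤ℕ p → + m / 1 ≤ + p / r
-- `_/_` reduces to lowest terms, so the comparison is moved to unnormalised fractions, where it is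
-- cross-multiplication. `mkℚᵘ` takes the denominator minus one.
m*r≤p⇒m/1≤p/r m p (suc r) le = ℚ.toℚᵘ-cancel-≤ (begin
  _                       ≃⟨ ℚ.toℚᵘ-fromℚᵘ (mkℚᵘ (+ m) 0) ⟩
  mkℚᵘ (+ m) 0            ≤⟨ *≤* (subst₂ _≤ℤ_ (ℤ.pos-* m (suc r))
                               (sym (ℤ.*-identityʳ (+ p))) (+≤+ le)) ⟩
  mkℚᵘ (+ p) r            ≃⟨ ℚ.toℚᵘ-fromℚᵘ (mkℚᵘ (+ p) r) ⟨
  _                       ∎)
  where open ℚᵘ.≤-Reasoning

theorem4 : (r n : ℕ) .{{_ : NonZero r}} (3≤r : 3 ≤ℕ r) → 1 ≤ℕ n →
    + exLin r n (crown r 3≤r) / 1 ≤ + ((2 * r ∸ 1) * n) / r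
theorem4 1 n (s≤s ())
theorem4 2 n (s≤s (s≤s ()))
theorem4 r@(suc (suc (suc k))) n 3≤r _ =
  -- The edgeless hypergraph shows that some size is attained, so the maximum is the size of an
  -- actual admissible `H`.
  let H , adm , eq = exLin-attained {r = r} (crown r 3≤r) (hypergraph {n} [] [])
                       (edgeless-admissible (crown r 3≤r) (here refl))
  in  m*r≤p⇒m/1≤p/r (exLin r n (crown r 3≤r)) ((2 * r ∸ 1) * n) r (begin
        exLin r n (crown r 3≤r) * r    ≡⟨ cong (_* r) eq ⟨
        size H * r                     ≤⟨ size-bound k 3≤r H adm ⟩
        ((3 + k) + (2 + k)) * n        ≡⟨ cong (_* n) (double k) ⟩
        (2 * r ∸ 1) * n                ∎)
  where
  open ℕ.≤-Reasoning
  -- The right-hand side is what `2 * r ∸ 1` computes to for `r` equal to `3 + k`.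
  double : ∀ k → 3 + k + (2 + k) ≡ 2 + (k + (3 + k + 0))
  double = solve-∀
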